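{- Let $\Delta, D, r$ be integers with $r \geq 0$ and $\Delta \geq D \geq r+2$. Then the automorphism group of the cycle prefix digraph $\Gamma_\Delta(D,-r)$ is isomorphic to the symmetric group $S_{\Delta+1}$ on the underlying set $\{1,2,\ldots,\Delta+1\}$.
   Context: The digraph $\Gamma_\Delta(D,-r)$: its vertices are the sequences $x_1x_2\ldots x_D$ of $D$ pairwise distinct elements of $\{1,2,\ldots,\Delta+1\}$. There is an arc from the vertex $x_1x_2\ldots x_D$ to each of the following vertices, and to no others: (rotations) $R_k(x_1x_2\ldots x_D) = x_k x_1 \ldots x_{k-1} x_{k+1} \ldots x_D$ for each $k$ with $r+2 \leq k \leq D$; (shifts) $S_m(x_1x_2\ldots x_D) = m x_1 x_2 \ldots x_{D-1}$ for each $m \in \{1,\ldots,\Delta+1\} \setminus \{x_1,\ldots,x_D\}$. An automorphism of a digraph $G=(V,E)$ is a permutation $\pi$ of $V$ such that $(u,v)\in E$ if and only if $(\pi(u),\pi(v))\in E$; the automorphisms form a group under composition, the automorphism group of $G$. -}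

module Defs where

open import Algebra.Bundles using (Group)
open import Algebra.Morphism.Structures using (IsGroupIsomorphism)
open import Data.Fin using (Fin; toℕ)
open import Data.Fin.Permutation as Perm
  using (Permutation′; _⟨$⟩ʳ_; _∘ₚ_; flip; inverseˡ; inverseʳ)
open import Data.Nat using (ℕ; suc; _+_; _≤_)
open import Data.Product using (∃; _,_)
open import Data.Refinement using (Refinement-syntax; value)
open import Data.Vec using (Vec; _∷_; lookup; removeAt; init)
open import Data.Vec.Membership.Propositional using (_∉_)
open import Data.Vec.Relation.Unary.Unique.Propositional using (Unique)
open import Function using (_↔_; _⇔_; Inverse; mk⇔)
open import Function.Construct.Composition using (_↔-∘_; _⇔-∘_)
open import Function.Construct.Identity using (↔-id; ⇔-id)
open import Function.Construct.Symmetry using (↔-sym; ⇔-sym)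
open import Level using (0ℓ)
open import Relation.Binary.Core using (Rel)
open import Relation.Binary.PropositionalEquality
  using (_≡_; refl; sym; trans; cong; subst₂)

record Digraph : Set₁ where
  field
    Vertex : Set
    Arc    : Rel Vertex 0ℓ

module _ (G : Digraph) where
  open Digraph G

  record Automorphism : Set where
    field
      perm : Vertex ↔ Vertex

    open Inverse perm public using (to; from; strictlyInverseˡ; strictlyInverseʳ)

    field
      arc⇔ : ∀ u v → Arc u v ⇔ Arc (to u) (to v)

  open Automorphism

  -- (π ∘ᴬ ρ) applies ρ first.
  _∘ᴬ_ : Automorphism → Automorphism → Automorphism
  (π ∘ᴬ ρ) .perm     = π .perm ↔-∘ ρ .perm
  (π ∘ᴬ ρ) .arc⇔ u v = arc⇔ π (to ρ u) (to ρ v) ⇔-∘ arc⇔ ρ u v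

  idᴬ : Automorphism
  idᴬ .perm     = ↔-id Vertex
  idᴬ .arc⇔ u v = ⇔-id (Arc u v)

  _⁻¹ᴬ : Automorphism → Automorphism
  (π ⁻¹ᴬ) .perm     = ↔-sym (π .perm)
  (π ⁻¹ᴬ) .arc⇔ u v =
    ⇔-sym (arc⇔ π (from π u) (from π v))
      ⇔-∘ mk⇔ (subst₂ Arc (sym (strictlyInverseˡ π u)) (sym (strictlyInverseˡ π v)))
              (subst₂ Arc (strictlyInverseˡ π u) (strictlyInverseˡ π v))

  automorphismGroup : Group 0ℓ 0ℓ
  automorphismGroup = record
    { Carrier = Automorphism
    ; _≈_     = λ π ρ → ∀ v → to π v ≡ to ρ v
    ; _∙_     = _∘ᴬ_
    ; ε       = idᴬ
    ; _⁻¹     = _⁻¹ᴬ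
    ; isGroup = record
      { isMonoid = record
        { isSemigroup = record
          { isMagma = record
            { isEquivalence = record
              { refl  = λ _ → refl
              ; sym   = λ π≈ρ v → sym (π≈ρ v)
              ; trans = λ π≈ρ ρ≈σ v → trans (π≈ρ v) (ρ≈σ v)
              }
            ; ∙-cong = λ {π} {_} {_} {σ} π≈π′ ρ≈σ v →
                trans (cong (to π) (ρ≈σ v)) (π≈π′ (to σ v))
            }
          ; assoc = λ _ _ _ _ → refl
          }
        ; identity = (λ _ _ → refl) , (λ _ _ → refl)
        }
      ; inverse = strictlyInverseʳ , strictlyInverseˡ
      ; ⁻¹-cong = λ {π} {ρ} π≈ρ v →
          trans (cong (from π) (sym (trans (π≈ρ (from ρ v)) (strictlyInverseˡ ρ v))))
                (strictlyInverseʳ π (from ρ v))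
      }
    }

-- `_∘ₚ_` composes left to right; flipping it makes (π ∙ ρ) apply ρ first.
symmetricGroup : ℕ → Group 0ℓ 0ℓ
symmetricGroup n = record
  { Carrier = Permutation′ n
  ; _≈_     = Perm._≈_
  ; _∙_     = λ π ρ → ρ ∘ₚ π
  ; ε       = Perm.id
  ; _⁻¹     = flip
  ; isGroup = record
    { isMonoid = record
      { isSemigroup = record
        { isMagma = record
          { isEquivalence = record
            { refl  = λ _ → refl
            ; sym   = λ π≈ρ i → sym (π≈ρ i)
            ; trans = λ π≈ρ ρ≈σ i → trans (π≈ρ i) (ρ≈σ i)
            }
          ; ∙-cong = λ {π} {_} {_} {σ} π≈π′ ρ≈σ i →
              trans (cong (π ⟨$⟩ʳ_) (ρ≈σ i)) (π≈π′ (σ ⟨$⟩ʳ i))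
          }
        ; assoc = λ _ _ _ _ → refl
        }
      ; identity = (λ _ _ → refl) , (λ _ _ → refl)
      }
    ; inverse = (λ π _ → inverseˡ π) , (λ π _ → inverseʳ π)
    ; ⁻¹-cong = λ {π} {ρ} π≈ρ i →
        trans (cong (flip π ⟨$⟩ʳ_) (sym (trans (π≈ρ (flip ρ ⟨$⟩ʳ i)) (inverseʳ ρ))))
              (inverseˡ π)
    }
  }

infix 4 _≅_

_≅_ : Group 0ℓ 0ℓ → Group 0ℓ 0ℓ → Set
G ≅ H = ∃ (IsGroupIsomorphism (Group.rawGroup G) (Group.rawGroup H))

module _ {A : Set} where

  -- Positions are 0-based: `rotate k` is R_{toℕ k + 1}.
  rotate : ∀ {n} → Fin n → Vec A n → Vec A n
  rotate k xs@(_ ∷ _) = lookup xs k ∷ removeAt xs k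

  shift : ∀ {n} → A → Vec A n → Vec A n
  shift m xs = init (m ∷ xs)

  data Step (r : ℕ) {n : ℕ} (xs ys : Vec A n) : Set where
    rotation : (k : Fin n) → r + 2 ≤ suc (toℕ k) → ys ≡ rotate k xs → Step r xs ys
    shifting : (m : A) → m ∉ xs → ys ≡ shift m xs → Step r xs ys

-- Γ Δ D r is Γ_Δ(D,−r), with Fin (Δ+1) as the alphabet {1,…,Δ+1}.  The
-- distinctness proof in a refinement is irrelevant, so vertices are equal
-- exactly when their sequences are.
Γ : ℕ → ℕ → ℕ → Digraph
Γ Δ D r = record
  { Vertex = [ xs ∈ Vec (Fin (suc Δ)) D ∣ Unique xs ]
  ; Arc    = λ u v → Step r (value u) (value v)
  }

{-# OPTIONS --safe #-}

-- Write u ⇝ v when deleting the first letter of v and the last letter of u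
-- leaves the same word; these pairs are the shifts and the rotation R_D.  An
-- arc R_k with k < D is reversed by a walk of length k − 1 < D − 1, namely
-- further R_k's, whereas for u ⇝ v every walk from v back to u has length at
-- least D − 1, since the last letter of u has to travel to the end.  Hence
-- automorphisms preserve ⇝.  A map f preserving ⇝ respects deletion of the
-- last and of the first letter, and induces the same map on words one letter
-- shorter in both ways; that map again preserves ⇝.  Descending to words of
-- length one, f is the letterwise action of a map on the alphabet.
module Submission where

open import Algebra.Bundles using (Group)
open import Algebra.Morphism.Structures using (IsGroupIsomorphism)
open import Data.Fin using (Fin; zero; suc; toℕ; fromℕ; inject₁; punchIn)
open import Data.Fin.Permutation as Perm using (Permutation′; permutation; _⟨$⟩ʳ_)
import Data.Fin.Properties as Fin
open import Data.Fin.Relation.Unary.Top using (view; ‵fromℕ; ‵inject₁)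
open import Data.Irrelevant using ([_])
open import Data.Nat using (ℕ; zero; suc; _+_; _∸_; _≤_; _<_; z≤n; s≤s; s≤s⁻¹)
open import Data.Nat.GeneralisedArithmetic using (fold; fold-+)
import Data.Nat.Properties as ℕ
open import Data.Product using (∃; _×_; _,_; proj₁; proj₂)
open import Data.Refinement using (Refinement-syntax; _,_; value; value-injective)
open import Data.Sum using (_⊎_; inj₁; inj₂)
open import Data.Vec using (Vec; []; _∷_; _∷ʳ_; head; tail; init; lookup; map; removeAt; tabulate)
open import Data.Vec.Membership.DecPropositional using () renaming (_∈?_ to mem?)
open import Data.Vec.Membership.Propositional using (_∈_; _∉_)
open import Data.Vec.Membership.Propositional.Properties using (∈-lookup; ∈-map⁺)
import Data.Vec.Properties as Vec
open import Data.Vec.Relation.Unary.All using (All; []; _∷_)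
open import Data.Vec.Relation.Unary.AllPairs as AllPairs using ([]; _∷_; allPairs?)
open import Data.Vec.Relation.Unary.Any using (here; there; index)
open import Data.Vec.Relation.Unary.Any.Properties using (lookup-index)
open import Data.Vec.Relation.Unary.Unique.Propositional using (Unique)
import Data.Vec.Relation.Unary.Unique.Propositional.Properties as Unique
open import Function using (_∘_; id; Injection; Equivalence; mk⇔; mk↔ₛ′)
open import Function.Properties.Inverse using (↔⇒↣)
open import Relation.Binary.PropositionalEquality
open import Relation.Nullary using (yes; no; contradiction; recompute)
open import Relation.Nullary.Decidable using (¬?)

open import Defs

-- Words over an alphabet

module _ {A : Set} where

  private variable
    d : ℕ
    x y : A
    xs ys : Vec A d

  lookup-init : ∀ (xs : Vec A (suc d)) i → lookup (init xs) i ≡ lookup xs (inject₁ i)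
  lookup-init (x ∷ y ∷ xs) zero    = refl
  lookup-init (x ∷ y ∷ xs) (suc i) = lookup-init (y ∷ xs) i

  lookup-removeAt : ∀ (xs : Vec A (suc d)) k i →
                    lookup (removeAt xs k) i ≡ lookup xs (punchIn k i)
  lookup-removeAt (x ∷ xs)     zero    i       = refl
  lookup-removeAt (x ∷ y ∷ xs) (suc k) zero    = refl
  lookup-removeAt (x ∷ y ∷ xs) (suc k) (suc i) = lookup-removeAt (y ∷ xs) k i

  removeAt-fromℕ : ∀ (xs : Vec A (suc d)) → removeAt xs (fromℕ d) ≡ init xs
  removeAt-fromℕ (x ∷ [])     = refl
  removeAt-fromℕ (x ∷ y ∷ xs) = cong (x ∷_) (removeAt-fromℕ (y ∷ xs))

  lookup-ext : (∀ i → lookup xs i ≡ lookup ys i) → xs ≡ ys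
  lookup-ext {xs = xs} {ys} eq = begin
    xs                   ≡⟨ Vec.tabulate∘lookup xs ⟨
    tabulate (lookup xs) ≡⟨ Vec.tabulate-cong eq ⟩
    tabulate (lookup ys) ≡⟨ Vec.tabulate∘lookup ys ⟩
    ys                   ∎
    where open ≡-Reasoning

  -- The first letter survives in `init` because the length is at least two; `tail` supplies the
  -- rest.
  init-tail-injective : ∀ (xs ys : Vec A (suc (suc d))) →
                        init xs ≡ init ys → tail xs ≡ tail ys → xs ≡ ys
  init-tail-injective (x ∷ xs) (y ∷ ys) i≡ t≡ = cong₂ _∷_ (Vec.∷-injectiveˡ i≡) t≡

  init-tail : ∀ (xs : Vec A (suc (suc d))) → init (tail xs) ≡ tail (init xs)
  init-tail (x ∷ xs) = refl

  head∷tail : ∀ (xs : Vec A (suc d)) → head xs ∷ tail xs ≡ xs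
  head∷tail (x ∷ xs) = refl

  head∈ : ∀ (xs : Vec A (suc d)) → head xs ∈ xs
  head∈ (x ∷ xs) = here refl

  head-∷ʳ : ∀ (xs : Vec A (suc d)) → head (xs ∷ʳ x) ≡ head xs
  head-∷ʳ (y ∷ xs) = refl

  ∈-init⁻ : ∀ (xs : Vec A (suc d)) → x ∈ init xs → x ∈ xs
  ∈-init⁻ (y ∷ z ∷ xs) (here eq)    = here eq
  ∈-init⁻ (y ∷ z ∷ xs) (there x∈xs) = there (∈-init⁻ (z ∷ xs) x∈xs)

  ∈-tail⁻ : ∀ (xs : Vec A (suc d)) → x ∈ tail xs → x ∈ xs
  ∈-tail⁻ (y ∷ xs) = there

  ∉-∷ʳ⁺ : ∀ (xs : Vec A d) → x ∉ xs → x ≢ y → x ∉ xs ∷ʳ y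
  ∉-∷ʳ⁺ []       x∉xs x≢y (here x≡y)    = x≢y x≡y
  ∉-∷ʳ⁺ (z ∷ xs) x∉xs x≢y (here x≡z)    = x∉xs (here x≡z)
  ∉-∷ʳ⁺ (z ∷ xs) x∉xs x≢y (there x∈xs′) = ∉-∷ʳ⁺ xs (x∉xs ∘ there) x≢y x∈xs′

  ∉⇒All≢ : ∀ (xs : Vec A d) → x ∉ xs → All (x ≢_) xs
  ∉⇒All≢ []       x∉xs = []
  ∉⇒All≢ (y ∷ xs) x∉xs = (x∉xs ∘ here) ∷ ∉⇒All≢ xs (x∉xs ∘ there)

  All≢⇒∉ : All (x ≢_) xs → x ∉ xs
  All≢⇒∉ (x≢y ∷ _)  (here x≡y)   = x≢y x≡y
  All≢⇒∉ (_ ∷ x≢xs) (there x∈xs) = All≢⇒∉ x≢xs x∈xs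

  head∉tail : ∀ {xs : Vec A (suc d)} → Unique xs → head xs ∉ tail xs
  head∉tail (x≢xs ∷ _) = All≢⇒∉ x≢xs

  Unique-lookup : (∀ {i j} → lookup xs i ≡ lookup xs j → i ≡ j) → Unique xs
  Unique-lookup {xs = xs} inj = subst Unique (Vec.tabulate∘lookup xs) (Unique.tabulate⁺ inj)

  Unique-init : ∀ {xs : Vec A (suc d)} → Unique xs → Unique (init xs)
  Unique-init {xs = xs} uniq = Unique-lookup λ {i} {j} eq →
    Fin.inject₁-injective (Unique.lookup-injective uniq _ _
      (trans (sym (lookup-init xs i)) (trans eq (lookup-init xs j))))

  Unique-∷ʳ : ∀ (xs : Vec A d) → Unique xs → y ∉ xs → Unique (xs ∷ʳ y)
  Unique-∷ʳ []       []           y∉xs = [] ∷ []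
  Unique-∷ʳ (x ∷ xs) (x≢xs ∷ uniq) y∉xs =
    ∉⇒All≢ (xs ∷ʳ _) (∉-∷ʳ⁺ xs (All≢⇒∉ x≢xs) (y∉xs ∘ here ∘ sym))
      ∷ Unique-∷ʳ xs uniq (y∉xs ∘ there)

module _ {A B : Set} {d : ℕ} (g : A → B) where

  head-map : (xs : Vec A (suc d)) → head (map g xs) ≡ g (head xs)
  head-map (x ∷ xs) = refl

  tail-map : (xs : Vec A (suc d)) → tail (map g xs) ≡ map g (tail xs)
  tail-map (x ∷ xs) = refl

init-map : ∀ {A B : Set} {d} (g : A → B) (xs : Vec A (suc d)) → init (map g xs) ≡ map g (init xs)
init-map g (x ∷ [])     = refl
init-map g (x ∷ y ∷ xs) = cong (g x ∷_) (init-map g (y ∷ xs))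

-- Pigeonhole: if every letter occurred, its index of occurrence would inject `Fin n` into `Fin d`.
fresh : ∀ {n d} → d < n → (xs : Vec (Fin n) d) → ∃ λ a → a ∉ xs
fresh {n} d<n xs = Fin.¬∀⟶∃¬ n (_∈ xs) (λ a → mem? Fin._≟_ a xs) λ all∈ →
  ℕ.<⇒≱ d<n (Fin.injective⇒≤ {f = index ∘ all∈} λ {a} {b} eq →
    trans (lookup-index (all∈ a)) (trans (cong (lookup xs) eq) (sym (lookup-index (all∈ b)))))

-- Words with distinct letters

Arrangement : ℕ → ℕ → Set
Arrangement n d = [ xs ∈ Vec (Fin n) d ∣ Unique xs ]

module _ {n : ℕ} where

  private variable
    d : ℕ

  -- Distinctness of letters is decidable, so the irrelevant proof can be recomputed.
  unique : (u : Arrangement n d) → Unique (value u)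
  unique (xs , [ uniq ]) = recompute (allPairs? (λ x y → ¬? (x Fin.≟ y)) xs) uniq

  lookup-injective : ∀ (u : Arrangement n d) {i j} →
                     lookup (value u) i ≡ lookup (value u) j → i ≡ j
  lookup-injective u = Unique.lookup-injective (unique u) _ _

  front back : Arrangement n (suc d) → Arrangement n d
  front (xs , [ uniq ]) = init xs , [ Unique-init uniq ]
  back  (xs , [ uniq ]) = tail xs , [ AllPairs.tail uniq ]

  cons snoc : (a : Fin n) (p : Arrangement n d) → a ∉ value p → Arrangement n (suc d)
  cons a (xs , [ uniq ]) a∉xs = a ∷ xs , [ ∉⇒All≢ xs a∉xs ∷ uniq ]
  snoc a (xs , [ uniq ]) a∉xs = xs ∷ʳ a , [ Unique-∷ʳ xs uniq a∉xs ]

  front-snoc : ∀ {a} {p : Arrangement n d} (a∉p : a ∉ value p) → front (snoc a p a∉p) ≡ p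
  front-snoc {a = a} {p} _ = value-injective (Vec.init-∷ʳ a (value p))

  extend : d < n → Arrangement n d → Arrangement n (suc d)
  extend d<n p = snoc (proj₁ (fresh d<n (value p))) p (proj₂ (fresh d<n (value p)))

  front-extend : ∀ (d<n : d < n) p → front (extend d<n p) ≡ p
  front-extend d<n p = front-snoc {p = p} (proj₂ (fresh d<n (value p)))

  front-back : (u : Arrangement n (suc (suc d))) → front (back u) ≡ back (front u)
  front-back u = value-injective (init-tail (value u))

  -- The relation `⇝` and descent to shorter words

  infix 4 _⇝_

  _⇝_ : Arrangement n (suc d) → Arrangement n (suc d) → Set
  u ⇝ v = back v ≡ front u

  Local : (Arrangement n (suc d) → Arrangement n (suc d)) → Set
  Local f = ∀ u v → u ⇝ v → f u ⇝ f v

  module Contraction {d} (d+2<n : suc (suc d) < n)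
    (f : Arrangement n (suc (suc d)) → Arrangement n (suc (suc d))) (f-local : Local f) where

    private
      d+1<n : suc d < n
      d+1<n = ℕ.<-trans (ℕ.n<1+n _) d+2<n

    -- Putting a fresh letter before the common front gives a common `⇝`-successor of `u` and `u′`;
    -- the back of its image equals both fronts.
    f-front : ∀ {u u′} → front u ≡ front u′ → front (f u) ≡ front (f u′)
    f-front {u} {u′} eq with a , a∉ ← fresh d+1<n (value (front u)) =
      trans (sym (f-local u (cons a (front u) a∉) refl)) (f-local u′ (cons a (front u) a∉) eq)

    -- By `f-front` the letter chosen by `extend` does not affect the result.
    contract : Arrangement n (suc d) → Arrangement n (suc d)
    contract p = front (f (extend d+1<n p))

    contract-front : ∀ u → contract (front u) ≡ front (f u)
    contract-front u = f-front (front-extend d+1<n (front u))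

    contract-back : ∀ u → contract (back u) ≡ back (f u)
    contract-back u = sym (f-local (extend d+1<n (back u)) u (sym (front-extend d+1<n (back u))))

    -- Here `p` and `q` are the back and the front of one longer word `v`, so their images are the
    -- back and the front of `f v`.
    contract-shift : ∀ {p q} → p ⇝ q → head (value q) ∉ value p → contract p ⇝ contract q
    contract-shift {p} {q} p⇝q a∉p = begin
      back (contract q)         ≡⟨ cong (back ∘ contract) q≡ ⟩
      back (contract (front v)) ≡⟨ cong back (contract-front v) ⟩
      back (front (f v))        ≡⟨ front-back (f v) ⟨
      front (back (f v))        ≡⟨ cong front (contract-back v) ⟨
      front (contract p)        ∎
      where
      open ≡-Reasoning
      v : Arrangement n (suc (suc d))
      v = cons (head (value q)) p a∉p
      q≡ : q ≡ front v
      q≡ = value-injective (trans (sym (head∷tail (value q)))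
                                  (cong (head (value q) ∷_) (cong value p⇝q)))

    -- contract-shift does not apply when the first letter of q is the last
    -- letter of p, but p and q are joined by a zigzag p ⇝ q′ ⇜ p′ ⇝ q of arcs
    -- to which it does.
    contract-local : Local contract
    contract-local p q p⇝q
      -- Avoiding `q`, the letter `z` keeps the head of `q` out of `p′`; avoiding both `z` and `p`,
      -- the letter `a` lies in neither `p` nor `p′`.
      with z , z∉q ← fresh d+1<n (value q)
      with a , a∉zp ← fresh d+2<n (z ∷ value p) =
      trans (contract-shift {p′} {q} (sym p′-front) h∉p′)
        (trans (sym (contract-shift {p′} {q′} (trans (sym p⇝q) (sym p′-front)) a∉p′))
               (contract-shift {p} {q′} refl (a∉zp ∘ there)))
      where
      z∉s : z ∉ value (back q)
      z∉s = z∉q ∘ ∈-tail⁻ (value q)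
      p′ q′ : Arrangement n (suc d)
      p′ = snoc z (back q) z∉s
      q′ = cons a (front p) (a∉zp ∘ there ∘ ∈-init⁻ (value p))
      p′-front : front p′ ≡ back q
      p′-front = front-snoc {p = back q} z∉s
      h∉p′ : head (value q) ∉ value p′
      h∉p′ = ∉-∷ʳ⁺ (value (back q)) (head∉tail (unique q))
        λ h≡z → z∉q (subst (_∈ value q) h≡z (head∈ (value q)))
      a∉p′ : a ∉ value p′
      a∉p′ = ∉-∷ʳ⁺ (value (back q))
        (λ a∈s → a∉zp (there (∈-init⁻ (value p) (subst (a ∈_) (cong value p⇝q) a∈s))))
        (a∉zp ∘ here)

    map-extends : ∀ g → (∀ p → value (contract p) ≡ map g (value p)) →
                  ∀ u → value (f u) ≡ map g (value u)
    map-extends g contract≡ u = init-tail-injective (value (f u)) (map g (value u))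
      (begin
        init (value (f u))         ≡⟨ cong value (contract-front u) ⟨
        value (contract (front u)) ≡⟨ contract≡ (front u) ⟩
        map g (init (value u))     ≡⟨ init-map g (value u) ⟨
        init (map g (value u))     ∎)
      (begin
        tail (value (f u))         ≡⟨ cong value (contract-back u) ⟨
        value (contract (back u))  ≡⟨ contract≡ (back u) ⟩
        map g (tail (value u))     ≡⟨ tail-map g (value u) ⟨
        tail (map g (value u))     ∎)
      where open ≡-Reasoning

  -- Induction on the length. A word of length one is a letter, so there `f` is itself a map of
  -- letters; the map found for `contract` then serves for `f`.
  Local⇒map : suc d < n → (f : Arrangement n (suc d) → Arrangement n (suc d)) → Local f →
              ∃ λ g → ∀ u → value (f u) ≡ map g (value u)
  Local⇒map {zero} _ f _ = (λ a → head (value (f (a ∷ [] , [ [] ∷ [] ])))) , f≡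
    where
    singleton : (xs : Vec (Fin n) 1) → xs ≡ head xs ∷ []
    singleton (x ∷ []) = refl
    f≡ : ∀ u → value (f u) ≡ map (λ a → head (value (f (a ∷ [] , [ [] ∷ [] ])))) (value u)
    f≡ (a ∷ [] , p) = singleton (value (f (a ∷ [] , p)))
  Local⇒map {suc d} d+2<n f f-local =
    proj₁ contract≡ , map-extends (proj₁ contract≡) (proj₂ contract≡)
    where
    open Contraction d+2<n f f-local
    contract≡ : ∃ λ g → ∀ p → value (contract p) ≡ map g (value p)
    contract≡ = Local⇒map (ℕ.<-trans (ℕ.n<1+n _) d+2<n) contract contract-local

  startingWith : d < n → Fin n → Arrangement n (suc d)
  startingWith {zero}  _   a = a ∷ [] , [ [] ∷ [] ]
  startingWith {suc d} d<n a = extend d<n (startingWith (ℕ.<-trans (ℕ.n<1+n d) d<n) a)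

  head-startingWith : ∀ (d<n : d < n) a → head (value (startingWith d<n a)) ≡ a
  head-startingWith {zero}  _   a = refl
  head-startingWith {suc d} d<n a =
    trans (head-∷ʳ (value (startingWith d′<n a))) (head-startingWith d′<n a)
    where
    d′<n : d < n
    d′<n = ℕ.<-trans (ℕ.n<1+n d) d<n

  -- Every letter is the head of some word, so the action on words determines the map on letters.
  map-faithful : d < n → (g h : Fin n → Fin n) →
                 (∀ (u : Arrangement n (suc d)) → map g (value u) ≡ map h (value u)) →
                 ∀ a → g a ≡ h a
  map-faithful d<n g h eq a = begin
    g a                    ≡⟨ cong g (head-startingWith d<n a) ⟨
    g (head (value u))     ≡⟨ head-map g (value u) ⟨
    head (map g (value u)) ≡⟨ cong head (eq u) ⟩
    head (map h (value u)) ≡⟨ head-map h (value u) ⟩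
    h (head (value u))     ≡⟨ cong h (head-startingWith d<n a) ⟩
    h a                    ∎
    where
    open ≡-Reasoning
    u : Arrangement n _
    u = startingWith d<n a

-- Rotations

-- The position from which `rotate k` takes its letter: zero goes to `k`, every other position up to
-- `k` goes down by one, and positions beyond `k` are fixed.
cycle : ∀ {d} → Fin (suc d) → Fin (suc d) → Fin (suc d)
cycle k zero    = k
cycle k (suc i) = punchIn k i

lookup-rotate : ∀ {A : Set} {d} (xs : Vec A (suc d)) k i →
                lookup (rotate k xs) i ≡ lookup xs (cycle k i)
lookup-rotate (x ∷ xs) k zero    = refl
lookup-rotate (x ∷ xs) k (suc i) = lookup-removeAt (x ∷ xs) k i

rotate-fromℕ : ∀ {A : Set} {d} (xs : Vec A (suc d)) →
               rotate (fromℕ d) xs ≡ lookup xs (fromℕ d) ∷ init xs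
rotate-fromℕ {d = d} xs@(_ ∷ _) = cong (lookup xs (fromℕ d) ∷_) (removeAt-fromℕ xs)

cycle-injective : ∀ {d} (k : Fin (suc d)) {i j} → cycle k i ≡ cycle k j → i ≡ j
cycle-injective k {zero}  {zero}  eq = refl
cycle-injective k {zero}  {suc j} eq = contradiction (sym eq) (Fin.punchInᵢ≢i k j)
cycle-injective k {suc i} {zero}  eq = contradiction eq (Fin.punchInᵢ≢i k i)
cycle-injective k {suc i} {suc j} eq = cong suc (Fin.punchIn-injective k i j eq)

toℕ-punchIn-< : ∀ {d} (k : Fin (suc d)) i → toℕ i < toℕ k → toℕ (punchIn k i) ≡ toℕ i
toℕ-punchIn-< (suc k) zero    _   = refl
toℕ-punchIn-< (suc k) (suc i) i<k = cong suc (toℕ-punchIn-< k i (s≤s⁻¹ i<k))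

punchIn-≥ : ∀ {d} (k : Fin (suc d)) i → toℕ k ≤ toℕ i → punchIn k i ≡ suc i
punchIn-≥ zero    i       _   = refl
punchIn-≥ (suc k) (suc i) k≤i = cong suc (punchIn-≥ k i (s≤s⁻¹ k≤i))

punchIn-≤ : ∀ {d} (k : Fin (suc d)) i → toℕ i ≤ toℕ (punchIn k i)
punchIn-≤ zero    i       = ℕ.n≤1+n _
punchIn-≤ (suc k) zero    = z≤n
punchIn-≤ (suc k) (suc i) = s≤s (punchIn-≤ k i)

-- Starting at `k`, each application of `cycle k` descends by one until zero is reached. The
-- additive form avoids truncated subtraction.
toℕ-fold-cycle : ∀ {d} (k : Fin (suc d)) j → j ≤ toℕ k → j + toℕ (fold k (cycle k) j) ≡ toℕ k
toℕ-fold-cycle k zero    _   = refl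
toℕ-fold-cycle k (suc j) j<k with fold k (cycle k) j | toℕ-fold-cycle k j (ℕ.<⇒≤ j<k)
... | zero  | eq = contradiction (trans (sym (ℕ.+-identityʳ j)) eq) (ℕ.<⇒≢ j<k)
... | suc i | eq = begin
  suc j + toℕ (punchIn k i) ≡⟨ cong (suc j +_) (toℕ-punchIn-< k i i<k) ⟩
  suc j + toℕ i             ≡⟨ ℕ.+-suc j (toℕ i) ⟨
  j + suc (toℕ i)           ≡⟨ eq ⟩
  toℕ k                     ∎
  where
  open ≡-Reasoning
  i<k : toℕ i < toℕ k
  i<k = subst (suc (toℕ i) ≤_) eq (ℕ.m≤n+m (suc (toℕ i)) j)

fold-fixed : ∀ {A : Set} {s : A → A} {x} → s x ≡ x → ∀ m → fold x s m ≡ x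
fold-fixed         sx≡x zero    = refl
fold-fixed {s = s} sx≡x (suc m) = trans (cong s (fold-fixed sx≡x m)) sx≡x

-- Positions beyond `k` are fixed. Any other lies on the orbit of `k`, and iterates commute, so it
-- suffices that `k` returns to itself.
cycle-order : ∀ {d} (k i : Fin (suc d)) → fold i (cycle k) (suc (toℕ k)) ≡ i
cycle-order k i with ℕ.≤-<-connex (toℕ i) (toℕ k)
cycle-order k (suc i) | inj₂ k≤i = fold-fixed {s = cycle k} (punchIn-≥ k i (s≤s⁻¹ k≤i)) (suc (toℕ k))
... | inj₁ i≤k = begin
  fold i c (suc K)                ≡⟨ cong (λ x → fold x c (suc K)) i≡ ⟩
  fold (fold k c e) c (suc K)     ≡⟨ fold-+ k c (suc K) ⟨
  fold k c (suc K + e)            ≡⟨ cong (fold k c) (ℕ.+-comm (suc K) e) ⟩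
  fold k c (e + suc K)            ≡⟨ fold-+ k c e ⟩
  -- After `K` steps `k` has reached zero, and `c zero` computes to `k`.
  fold (fold k c (suc K)) c e     ≡⟨ cong (λ x → fold (c x) c e) last≡zero ⟩
  fold k c e                      ≡⟨ i≡ ⟨
  i                               ∎
  where
  open ≡-Reasoning
  c : Fin _ → Fin _
  c = cycle k
  K e : ℕ
  K = toℕ k
  e = K ∸ toℕ i
  i≡ : i ≡ fold k c e
  i≡ = Fin.toℕ-injective (ℕ.+-cancelˡ-≡ e _ _
    (trans (ℕ.m∸n+n≡m i≤k) (sym (toℕ-fold-cycle k e (ℕ.m∸n≤m K (toℕ i))))))
  last≡zero : fold k c K ≡ zero
  last≡zero = Fin.toℕ-injective (ℕ.+-cancelˡ-≡ K _ _
    (trans (toℕ-fold-cycle k K ℕ.≤-refl) (sym (ℕ.+-identityʳ K))))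

rotateᴬ : ∀ {n d} → Fin (suc d) → Arrangement n (suc d) → Arrangement n (suc d)
rotateᴬ k u@(xs , _) = rotate k xs , [ Unique-lookup (λ {i} {j} eq →
  cycle-injective k (lookup-injective u
    (trans (sym (lookup-rotate xs k i)) (trans eq (lookup-rotate xs k j))))) ]

-- Position maps compose in the opposite order to rotations, so the last rotation contributes the
-- innermost `cycle k`; `fold-+` absorbs it into the iterate.
lookup-fold-rotate : ∀ {n d} (k : Fin (suc d)) (u : Arrangement n (suc d)) j i →
  lookup (value (fold u (rotateᴬ k) j)) i ≡ lookup (value u) (fold i (cycle k) j)
lookup-fold-rotate k u zero    i = refl
lookup-fold-rotate k u (suc j) i = begin
  lookup (rotate k (value (fold u (rotateᴬ k) j))) i ≡⟨ lookup-rotate (value (fold u (rotateᴬ k) j)) k i ⟩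
  lookup (value (fold u (rotateᴬ k) j)) (cycle k i)  ≡⟨ lookup-fold-rotate k u j (cycle k i) ⟩
  lookup (value u) (fold (cycle k i) (cycle k) j)    ≡⟨ cong (lookup (value u)) (fold-+ i (cycle k) j) ⟨
  lookup (value u) (fold i (cycle k) (j + 1))        ≡⟨ cong (lookup (value u) ∘ fold i (cycle k)) (ℕ.+-comm j 1) ⟩
  lookup (value u) (fold i (cycle k) (suc j))        ∎
  where open ≡-Reasoning

rotate-order : ∀ {n d} (k : Fin (suc d)) (u : Arrangement n (suc d)) →
               fold u (rotateᴬ k) (suc (toℕ k)) ≡ u
rotate-order k u = value-injective (lookup-ext λ i →
  trans (lookup-fold-rotate k u (suc (toℕ k)) i) (cong (lookup (value u)) (cycle-order k i)))

-- Walks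

data Walk (G : Digraph) : ℕ → Digraph.Vertex G → Digraph.Vertex G → Set where
  ε   : ∀ {u} → Walk G 0 u u
  _▷_ : ∀ {j u v w} → Walk G j u v → Digraph.Arc G v w → Walk G (suc j) u w

module _ {G : Digraph} (π : Automorphism G) where
  open Automorphism π

  arc⁺ : ∀ {u v} → Digraph.Arc G u v → Digraph.Arc G (to u) (to v)
  arc⁺ = Equivalence.to (arc⇔ _ _)

  walk⁺ : ∀ {j u v} → Walk G j u v → Walk G j (to u) (to v)
  walk⁺ ε       = ε
  walk⁺ (w ▷ s) = walk⁺ w ▷ arc⁺ s

walk⁻ : ∀ {G} (π : Automorphism G) {j u v} →
        Walk G j (Automorphism.to π u) (Automorphism.to π v) → Walk G j u v
walk⁻ {G} π {j} w = subst₂ (Walk G j) (Automorphism.strictlyInverseʳ π _)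
  (Automorphism.strictlyInverseʳ π _) (walk⁺ (_⁻¹ᴬ G π) w)

-- Traces a letter backwards through an arc: away from the front, it stood at most one position
-- earlier before the arc.
step-lookup : ∀ {A : Set} {r d} {xs ys : Vec A (suc d)} → Step r xs ys → ∀ i →
              ∃ λ j → lookup ys (suc i) ≡ lookup xs j × toℕ i ≤ toℕ j
step-lookup {xs = xs} (rotation k _ refl) i =
  punchIn k i , lookup-rotate xs k (suc i) , punchIn-≤ k i
step-lookup {xs = xs} (shifting m _ refl) i =
  inject₁ i , lookup-init xs i , ℕ.≤-reflexive (sym (Fin.toℕ-inject₁ i))

module _ {Δ d r : ℕ} where

  private
    G : Digraph
    G = Γ Δ (suc d) r

    V : Set
    V = Arrangement (suc Δ) (suc d)

  -- Tracing a letter back along the walk either reaches `u` or stops where the letter was at the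
  -- front; the first alternative covers the latter, with fewer than `j` arcs left to move it.
  walk-lookup : ∀ {j} {u v : V} → Walk G j u v → ∀ i → toℕ i < j ⊎
                ∃ λ i′ → lookup (value v) i ≡ lookup (value u) i′ × toℕ i ≤ j + toℕ i′
  walk-lookup ε       i       = inj₂ (i , refl , ℕ.≤-refl)
  walk-lookup (w ▷ s) zero    = inj₁ (s≤s z≤n)
  walk-lookup (w ▷ s) (suc i) with i₁ , eq₁ , i≤i₁ ← step-lookup s i | walk-lookup w i₁
  ... | inj₁ i₁<j               = inj₁ (s≤s (ℕ.≤-<-trans i≤i₁ i₁<j))
  ... | inj₂ (i₂ , eq₂ , i₁≤) = inj₂ (i₂ , trans eq₁ eq₂ , s≤s (ℕ.≤-trans i≤i₁ i₁≤))

  -- The last letter of u is at the front of v or absent from it, and a step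
  -- moves a letter back by at most one position.
  ⇝-return-long : ∀ {k} {u v : V} → u ⇝ v → Walk G k v u → d ≤ k
  ⇝-return-long {k} {u} {v} u⇝v w with walk-lookup w (fromℕ d)
  ... | inj₁ d<k = ℕ.<⇒≤ (subst (_< k) (Fin.toℕ-fromℕ d) d<k)
  ... | inj₂ (zero , _ , d≤) = subst₂ _≤_ (Fin.toℕ-fromℕ d) (ℕ.+-identityʳ k) d≤
  ... | inj₂ (suc i , eq , _) = contradiction (lookup-injective u (begin
    lookup (value u) (fromℕ d)   ≡⟨ eq ⟩
    lookup (value v) (suc i)     ≡⟨ cong (λ xs → lookup xs (suc i)) (head∷tail (value v)) ⟨
    lookup (tail (value v)) i    ≡⟨ cong (λ p → lookup (value p) i) u⇝v ⟩
    lookup (init (value u)) i    ≡⟨ lookup-init (value u) i ⟩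
    lookup (value u) (inject₁ i) ∎)) Fin.fromℕ≢inject₁
    where open ≡-Reasoning

  walk-rotations : ∀ k → r + 2 ≤ suc (toℕ k) → ∀ (u : V) j → Walk G j u (fold u (rotateᴬ k) j)
  walk-rotations k r+2≤k u zero    = ε
  walk-rotations k r+2≤k u (suc j) = walk-rotations k r+2≤k u j ▷ rotation k r+2≤k refl

  -- The rotation has order dividing `suc (toℕ k)`, so `toℕ k` further copies undo it.
  rotation-return : ∀ k → r + 2 ≤ suc (toℕ k) → ∀ (u : V) → Walk G (toℕ k) (rotateᴬ k u) u
  rotation-return k r+2≤k u = subst (Walk G (toℕ k) (rotateᴬ k u)) (begin
    fold (rotateᴬ k u) (rotateᴬ k) (toℕ k) ≡⟨ fold-+ u (rotateᴬ k) (toℕ k) ⟨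
    fold u (rotateᴬ k) (toℕ k + 1)         ≡⟨ cong (fold u (rotateᴬ k)) (ℕ.+-comm (toℕ k) 1) ⟩
    fold u (rotateᴬ k) (suc (toℕ k))       ≡⟨ rotate-order k u ⟩
    u                                      ∎)
    (walk-rotations k r+2≤k (rotateᴬ k u) (toℕ k))
    where open ≡-Reasoning

  -- Shifts and the rotation at the last position are of the first kind; any other rotation has
  -- `toℕ k < d`. By `⇝-return-long` the two kinds exclude each other.
  arc⇒⇝⊎short-return : ∀ {u v : V} → Digraph.Arc G u v →
                        u ⇝ v ⊎ ∃ λ k → k < d × Walk G k v u
  arc⇒⇝⊎short-return {u} (shifting m _ eq) = inj₁ (value-injective (cong tail eq))
  arc⇒⇝⊎short-return {u} {v} (rotation k r+2≤k eq) with view k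
  ... | ‵fromℕ     = inj₁ (value-injective (cong tail (trans eq (rotate-fromℕ (value u)))))
  ... | ‵inject₁ i = inj₂ (toℕ k , subst (_< d) (sym (Fin.toℕ-inject₁ i)) (Fin.toℕ<n i) ,
    subst (λ w → Walk G (toℕ k) w u) (value-injective (sym eq)) (rotation-return k r+2≤k u))

  -- If the head of `v` is absent from `u`, the arc is a shift; if it is the last letter of `u`, a
  -- rotation. Elsewhere in `u` it would lie in `front u`, hence in `back v`, and repeat in `v`.
  ⇝⇒arc : r + 2 ≤ suc d → ∀ {u v : V} → u ⇝ v → Digraph.Arc G u v
  ⇝⇒arc r+2≤D {u} {v} u⇝v with mem? Fin._≟_ (head (value v)) (value u)
  ... | no  h∉u = shifting (head (value v)) h∉u
    (trans (sym (head∷tail (value v))) (cong (head (value v) ∷_) (cong value u⇝v)))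
  ... | yes h∈u with index h∈u | lookup-index h∈u
  ... | k | h≡ with view k
  ... | ‵fromℕ = rotation (fromℕ d) (subst (λ m → r + 2 ≤ suc m) (sym (Fin.toℕ-fromℕ d)) r+2≤D)
    (begin
      value v                                     ≡⟨ head∷tail (value v) ⟨
      head (value v) ∷ tail (value v)             ≡⟨ cong₂ _∷_ h≡ (cong value u⇝v) ⟩
      lookup (value u) (fromℕ d) ∷ init (value u) ≡⟨ rotate-fromℕ (value u) ⟨
      rotate (fromℕ d) (value u)                  ∎)
    where open ≡-Reasoning
  ... | ‵inject₁ i = contradiction
    (subst₂ (λ a xs → a ∈ xs) (trans (lookup-init (value u) i) (sym h≡)) (sym (cong value u⇝v))
      (∈-lookup i (init (value u))))
    (head∉tail (unique v))

  -- Otherwise the image arc would have a short return walk, and its preimage would lead from `v`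
  -- back to `u` in fewer than `d` arcs.
  automorphism-local : r + 2 ≤ suc d → (π : Automorphism G) → Local (Automorphism.to π)
  automorphism-local r+2≤D π u v u⇝v with arc⇒⇝⊎short-return (arc⁺ π (⇝⇒arc r+2≤D {u} {v} u⇝v))
  ... | inj₁ πu⇝πv         = πu⇝πv
  ... | inj₂ (k , k<d , w) = contradiction (⇝-return-long u⇝v (walk⁻ π w)) (ℕ.<⇒≱ k<d)

-- Automorphisms from permutations of the alphabet

rotate-map : ∀ {A B : Set} {d} (g : A → B) (k : Fin d) (xs : Vec A d) →
             rotate k (map g xs) ≡ map g (rotate k xs)
rotate-map g k xs@(_ ∷ _) = lookup-ext λ i → begin
  lookup (rotate k (map g xs)) i ≡⟨ lookup-rotate (map g xs) k i ⟩
  lookup (map g xs) (cycle k i)  ≡⟨ Vec.lookup-map (cycle k i) g xs ⟩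
  g (lookup xs (cycle k i))      ≡⟨ cong g (lookup-rotate xs k i) ⟨
  g (lookup (rotate k xs) i)     ≡⟨ Vec.lookup-map i g (rotate k xs) ⟨
  lookup (map g (rotate k xs)) i ∎
  where open ≡-Reasoning

module _ {Δ D r : ℕ} where

  private
    G : Digraph
    G = Γ Δ D r

    V : Set
    V = Arrangement (suc Δ) D

    word : V → Vec (Fin (suc Δ)) D
    word = value

  relabel : Permutation′ (suc Δ) → V → V
  relabel σ (xs , [ uniq ]) = map (σ ⟨$⟩ʳ_) xs , [ Unique.map⁺ (Injection.injective (↔⇒↣ σ)) uniq ]

  relabel-∘ : ∀ (σ τ : Permutation′ (suc Δ)) → (∀ a → σ ⟨$⟩ʳ (τ ⟨$⟩ʳ a) ≡ a) →
              ∀ u → relabel σ (relabel τ u) ≡ u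
  relabel-∘ σ τ στ≡id u = value-injective (begin
    map (σ ⟨$⟩ʳ_) (map (τ ⟨$⟩ʳ_) (word u)) ≡⟨ Vec.map-∘ (σ ⟨$⟩ʳ_) (τ ⟨$⟩ʳ_) (word u) ⟨
    map (λ a → σ ⟨$⟩ʳ (τ ⟨$⟩ʳ a)) (word u) ≡⟨ Vec.map-cong στ≡id (word u) ⟩
    map id (word u)                        ≡⟨ Vec.map-id (word u) ⟩
    word u                                 ∎)
    where open ≡-Reasoning

  relabel-arc : ∀ σ u v → Digraph.Arc G u v → Digraph.Arc G (relabel σ u) (relabel σ v)
  relabel-arc σ u v (rotation k r+2≤k eq) = rotation k r+2≤k
    (trans (cong (map (σ ⟨$⟩ʳ_)) eq) (sym (rotate-map (σ ⟨$⟩ʳ_) k (word u))))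
  relabel-arc σ u v (shifting m m∉u eq) = shifting (σ ⟨$⟩ʳ m)
    -- If the new letter occurred in the relabelled word, undoing the relabelling would place `m` in
    -- `u`.
    (λ σm∈ → m∉u (subst₂ (λ a xs → a ∈ xs) (Perm.inverseˡ σ)
      (cong word (relabel-∘ (Perm.flip σ) σ (λ _ → Perm.inverseˡ σ) u)) (∈-map⁺ (Perm.flip σ ⟨$⟩ʳ_) σm∈)))
    (trans (cong (map (σ ⟨$⟩ʳ_)) eq) (sym (init-map (σ ⟨$⟩ʳ_) (m ∷ word u))))

  relabelling : Permutation′ (suc Δ) → Automorphism G
  relabelling σ = record
    { perm = mk↔ₛ′ (relabel σ) (relabel (Perm.flip σ)) σσ⁻¹≡id σ⁻¹σ≡id
    ; arc⇔ = λ u v → mk⇔ (relabel-arc σ u v)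
        (subst₂ (Digraph.Arc G) (σ⁻¹σ≡id u) (σ⁻¹σ≡id v)
          ∘ relabel-arc (Perm.flip σ) (relabel σ u) (relabel σ v))
    }
    where
    σσ⁻¹≡id : ∀ u → relabel σ (relabel (Perm.flip σ) u) ≡ u
    σσ⁻¹≡id = relabel-∘ σ (Perm.flip σ) (λ _ → Perm.inverseʳ σ)
    σ⁻¹σ≡id : ∀ u → relabel (Perm.flip σ) (relabel σ u) ≡ u
    σ⁻¹σ≡id = relabel-∘ (Perm.flip σ) σ (λ _ → Perm.inverseˡ σ)

-- The isomorphism with the symmetric group

module _ {Δ d r : ℕ} (d<Δ : d < Δ) (r+2≤D : r + 2 ≤ suc d) where

  private
    G : Digraph
    G = Γ Δ (suc d) r

    A : Set
    A = Fin (suc Δ)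

    open Automorphism

    d<n : d < suc Δ
    d<n = ℕ.m<n⇒m<1+n d<Δ

  automorphism⇒map : (π : Automorphism G) →
                     ∃ λ (g : A → A) → ∀ u → value (to π u) ≡ map g (value u)
  automorphism⇒map π = Local⇒map (s≤s d<Δ) (to π) (automorphism-local r+2≤D π)

  onLetters : Automorphism G → A → A
  onLetters π = proj₁ (automorphism⇒map π)

  to-onLetters : ∀ π u → value (to π u) ≡ map (onLetters π) (value u)
  to-onLetters π = proj₂ (automorphism⇒map π)

  -- Reduces each law for `onLetters` to exhibiting a letter map with the right action on words.
  onLetters-unique : ∀ π (g : A → A) → (∀ u → value (to π u) ≡ map g (value u)) →
                     ∀ a → onLetters π a ≡ g a
  onLetters-unique π g eq =
    map-faithful d<n (onLetters π) g λ u → trans (sym (to-onLetters π u)) (eq u)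

  onLetters-id : ∀ π → (∀ u → to π u ≡ u) → ∀ a → onLetters π a ≡ a
  onLetters-id π eq = onLetters-unique π id λ u → trans (cong value (eq u)) (sym (Vec.map-id (value u)))

  onLetters-∘ : ∀ π ρ a → onLetters (_∘ᴬ_ G π ρ) a ≡ onLetters π (onLetters ρ a)
  onLetters-∘ π ρ = onLetters-unique (_∘ᴬ_ G π ρ) (onLetters π ∘ onLetters ρ) λ u → begin
    value (to π (to ρ u))                           ≡⟨ to-onLetters π (to ρ u) ⟩
    map (onLetters π) (value (to ρ u))              ≡⟨ cong (map (onLetters π)) (to-onLetters ρ u) ⟩
    map (onLetters π) (map (onLetters ρ) (value u)) ≡⟨ Vec.map-∘ (onLetters π) (onLetters ρ) (value u) ⟨
    map (onLetters π ∘ onLetters ρ) (value u)       ∎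
    where open ≡-Reasoning

  letterPermutation : Automorphism G → Permutation′ (suc Δ)
  letterPermutation π = permutation (onLetters π) (onLetters π⁻¹)
    (λ a → trans (sym (onLetters-∘ π π⁻¹ a)) (onLetters-id (_∘ᴬ_ G π π⁻¹) (strictlyInverseˡ π) a))
    (λ a → trans (sym (onLetters-∘ π⁻¹ π a)) (onLetters-id (_∘ᴬ_ G π⁻¹ π) (strictlyInverseʳ π) a))
    where
    π⁻¹ : Automorphism G
    π⁻¹ = _⁻¹ᴬ G π

  letterPermutation-isGroupIsomorphism :
    IsGroupIsomorphism (Group.rawGroup (automorphismGroup G))
                       (Group.rawGroup (symmetricGroup (suc Δ))) letterPermutation
  letterPermutation-isGroupIsomorphism = record
    { isGroupMonomorphism = record
      { isGroupHomomorphism = record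
        { isMonoidHomomorphism = record
          { isMagmaHomomorphism = record
            { isRelHomomorphism = record { cong = λ {π} {ρ} π≈ρ →
                onLetters-unique π (onLetters ρ) λ u →
                  trans (cong value (π≈ρ u)) (to-onLetters ρ u) }
            ; homo              = onLetters-∘
            }
          ; ε-homo = onLetters-id (idᴬ G) λ _ → refl
          }
        -- `letterPermutation π` was given the letter map of the inverse automorphism as its
        -- inverse, so both sides coincide by definition.
        ; ⁻¹-homo = λ _ _ → refl
        }
      ; injective = λ {π} {ρ} eq u → value-injective (begin
          value (to π u)              ≡⟨ to-onLetters π u ⟩
          map (onLetters π) (value u) ≡⟨ Vec.map-cong eq (value u) ⟩
          map (onLetters ρ) (value u) ≡⟨ to-onLetters ρ u ⟨
          value (to ρ u)              ∎)
      }
    -- The preimage of `σ` is its letterwise action; surjectivity up to equivalence asks this for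
    -- every `π` that agrees with it on words.
    ; surjective = λ σ → relabelling σ , λ {π} π≈σ →
        onLetters-unique π (σ ⟨$⟩ʳ_) λ u → cong value (π≈σ u)
    }
    where open ≡-Reasoning

theorem2p1 : (Δ D r : ℕ) → D ≤ Δ → r + 2 ≤ D →
    automorphismGroup (Γ Δ D r) ≅ symmetricGroup (suc Δ)
theorem2p1 Δ zero    r _   r+2≤0 with () ← ℕ.m+n≤o⇒n≤o r r+2≤0
theorem2p1 Δ (suc d) r d<Δ r+2≤D =
  letterPermutation d<Δ r+2≤D , letterPermutation-isGroupIsomorphism d<Δ r+2≤D
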